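{- Let $P$ be a level poset with underlying digraph $G$ on the vertex set $V$, and let $<$ be a vertex shelling order on $V$. Let $[(u,i),(v,j)]$ be an interval of $P$ with $(u,i)<(v,j)$, and associate to each maximal chain $$(u,i)=(v_{i},i)\prec (v_{i+1},i+1)\prec \cdots \prec (v_{j-1},j-1)\prec (v_{j},j)=(v,j)$$ of this interval the word $v_{i}v_{i+1}\cdots v_{j}$. Then ordering the maximal chains of $[(u,i),(v,j)]$ by increasing lexicographic order (with respect to $<$) of the associated words is a shelling of the order complex $\Delta([(u,i),(v,j)])$.
   Context: Digraphs are finite and may have loops but no multiple edges. The level poset of a digraph $G$ on a finite nonempty vertex set $V$ is the poset on $V\times\mathbb{Z}$ with $(u,i)<(v,j)$ if and only if $i<j$ and there is a directed walk of length $j-i$ from $u$ to $v$ in $G$; $G$ is its underlying digraph. Here $\prec$ denotes the cover relation. Vertex shelling order: a linear order $<$ on the vertex set $V$ of a digraph $G$ such that for any $u,v\in V$ and every pair of walks $u=v_0\to v_1\to\cdots\to v_k=v$ and $u=v_0'\to v_1'\to\cdots\to v_k'=v$ of the same length with $v_1'<v_1$, there are a $j\in\{1,\dots,k-1\}$ and a vertex $w\in V$ such that $w<v_j$ and both $v_{j-1}\to w$ and $w\to v_{j+1}$ are edges of $G$. For a finite graded poset $Q$ with minimum $\hat 0$ and maximum $\hat 1$, the order complex $\Delta(Q)$ is the simplicial complex on the vertex set $Q\setminus\{\hat0,\hat1\}$ whose faces are the chains contained in $Q\setminus\{\hat 0,\hat 1\}$; its facets correspond to the maximal chains of $Q$ (by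 removing $\hat 0,\hat 1$). A shelling of a pure simplicial complex $\Delta$ is an ordering $F_1,\dots,F_t$ of its facets such that for every $k\in\{2,\dots,t\}$ the collection of faces of $F_k$ contained in some $F_i$ with $i<k$ is a pure simplicial complex of dimension $\dim(\Delta)-1$. -}

module Defs where

open import Data.Fin.Base as Fin using (Fin; zero; suc; toℕ; inject₁)
import Data.Fin.Properties as Fin
open import Data.Integer.Base as ℤ using (ℤ; +_; ∣_∣; 1ℤ)
import Data.Integer.Properties as ℤ
open import Data.Integer.Tactic.RingSolver using (solve-∀)
open import Data.List.Base using (List; []; _∷_; length; lookup; map; filter)
open import Data.List.Membership.Propositional using (_∈_)
open import Data.List.Relation.Binary.BagAndSetEquality using (set; _∼[_]_)
open import Data.List.Relation.Binary.Lex.Strict using (Lex-<)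
open import Data.List.Relation.Binary.Subset.Propositional using (_⊆_)
open import Data.List.Relation.Unary.All using (All)
open import Data.List.Relation.Unary.AllPairs using (AllPairs)
open import Data.List.Relation.Unary.Any using (Any)
open import Data.List.Relation.Unary.Linked using (Linked)
open import Data.List.Relation.Unary.Unique.Propositional using (Unique)
open import Data.Nat.Base as ℕ using (ℕ; zero; suc)
open import Data.Product.Base using (Σ-syntax; ∃-syntax; _×_; _,_; proj₁)
open import Data.Product.Properties using (≡-dec)
open import Data.Sum.Base using (_⊎_)
open import Function.Bundles using (_↔_)
open import Function.Properties.Inverse using (↔⇒↣)
open import Level using (0ℓ)
open import Relation.Binary.Bundles using (StrictPartialOrder)
open import Relation.Binary.Core using (Rel)
open import Relation.Binary.Definitions using (Decidable; DecidableEquality; Transitive)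
open import Relation.Binary.PropositionalEquality
  using (_≡_; _≢_; refl; sym; cong; cong₂; subst; isEquivalence; resp₂; module ≡-Reasoning)
open import Relation.Binary.Structures using (IsStrictTotalOrder)
open import Relation.Nullary.Decidable using (_×-dec_; ¬?; via-injection)
open import Relation.Nullary.Negation using (¬_)
open import Relation.Unary using (Pred)

------------------------------------------------------------------------
-- Simplicial complexes
--
-- A finite subset of X is represented by a duplicate-free list, in any
-- order; two lists are the same set when they are related by _∼[ set ]_.

module _ {X : Set} where

  dim : List X → ℤ
  dim σ = + length σ ℤ.- 1ℤ

  record IsSimplicialComplex (Δ : Pred (List X) 0ℓ) : Set where
    field
      faces-unique : ∀ {σ} → Δ σ → Unique σ
      down-closed  : ∀ {σ τ} → Δ σ → Unique τ → τ ⊆ σ → Δ τ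

  IsFacet : Pred (List X) 0ℓ → Pred (List X) 0ℓ
  IsFacet Δ σ = Δ σ × (∀ {τ} → Δ τ → σ ⊆ τ → τ ⊆ σ)

  record IsPure (Δ : Pred (List X) 0ℓ) (d : ℤ) : Set where
    field
      isSimplicialComplex : IsSimplicialComplex Δ
      dim-attained        : ∃[ σ ] (Δ σ × dim σ ≡ d)
      dim-bound           : ∀ {σ} → Δ σ → dim σ ℤ.≤ d
      facets-dim          : ∀ {σ} → IsFacet Δ σ → dim σ ≡ d

  record IsFacetOrdering (Δ : Pred (List X) 0ℓ) (Fs : List (List X)) : Set where
    field
      facets   : All (IsFacet Δ) Fs
      complete : ∀ {F} → IsFacet Δ F → Any (F ∼[ set ]_) Fs
      distinct : AllPairs (λ F F′ → ¬ (F ∼[ set ] F′)) Fs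

  -- The faces of the k-th facet that lie in an earlier facet.
  EarlierFaces : (Fs : List (List X)) → Fin (length Fs) → Pred (List X) 0ℓ
  EarlierFaces Fs k σ =
    Unique σ × σ ⊆ lookup Fs k × ∃[ i ] (i Fin.< k × σ ⊆ lookup Fs i)

  -- Positions count from 0, so the first facet is the one excluded by
  -- 0 < toℕ k.  The complex {∅} is pure of dimension -1.
  record IsShelling (Δ : Pred (List X) 0ℓ) (Fs : List (List X)) : Set where
    field
      dimension       : ℤ
      isPure          : IsPure Δ dimension
      isFacetOrdering : IsFacetOrdering Δ Fs
      earlier-pure    : (k : Fin (length Fs)) → 0 ℕ.< toℕ k →
                        IsPure (EarlierFaces Fs k) (dimension ℤ.- 1ℤ)

------------------------------------------------------------------------
-- Chains and order complexes

module Order {A : Set} (_<_ : Rel A 0ℓ) where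

  _≤_ : Rel A 0ℓ
  x ≤ y = x < y ⊎ x ≡ y

  _⋖_ : Rel A 0ℓ
  x ⋖ y = x < y × ¬ (∃[ z ] (x < z × z < y))

  Interval : A → A → Pred A 0ℓ
  Interval x y z = x ≤ z × z ≤ y

  record IsChain (Q : Pred A 0ℓ) (C : List A) : Set where
    field
      unique     : Unique C
      inside     : ∀ {x} → x ∈ C → Q x
      comparable : ∀ {x y} → x ∈ C → y ∈ C → x ≤ y ⊎ y ≤ x

  IsMaximalChain : Pred A 0ℓ → Pred (List A) 0ℓ
  IsMaximalChain Q C = IsChain Q C × (∀ {D} → IsChain Q D → C ⊆ D → D ⊆ C)

  -- The order complex of the subposet Q with minimum 0̂ and maximum 1̂.
  OrderComplex : Pred A 0ℓ → (0̂ 1̂ : A) → Pred (List A) 0ℓ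
  OrderComplex Q 0̂ 1̂ = IsChain (λ x → Q x × x ≢ 0̂ × x ≢ 1̂)

------------------------------------------------------------------------
-- Digraphs

record Digraph : Set₁ where
  infix 4 _⟶_
  field
    V        : Set
    size-1   : ℕ
    finite   : V ↔ Fin (suc size-1)
    _⟶_      : Rel V 0ℓ
    -- The edge set is a finite subset of V × V.
    _⟶?_     : Decidable _⟶_

  _≟_ : DecidableEquality V
  _≟_ = via-injection (↔⇒↣ finite) Fin._≟_

  data Walk : ℕ → V → V → Set where
    []  : ∀ {u} → Walk 0 u u
    _∷_ : ∀ {k u v w} → u ⟶ v → Walk k v w → Walk (suc k) u w

  -- The vertices v₀ , … , vₖ of a walk of length k.
  vertex : ∀ {k u v} → Walk k u v → Fin (suc k) → V
  vertex {u = u} _       zero    = u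
  vertex         (_ ∷ p) (suc i) = vertex p i

  _++ʷ_ : ∀ {k l u v w} → Walk k u v → Walk l v w → Walk (k ℕ.+ l) u w
  []      ++ʷ q = q
  (e ∷ p) ++ʷ q = e ∷ (p ++ʷ q)

  -- For walks p, p′ of length m + 1, an index j : Fin m stands for the
  -- interior position j + 1, so the three vertices below are the ones at
  -- positions j, j + 1 and j + 2 of p.
  record IsVertexShellingOrder (_<_ : Rel V 0ℓ) : Set where
    field
      isStrictTotalOrder : IsStrictTotalOrder _≡_ _<_
      exchange : ∀ {m u v} (p p′ : Walk (suc m) u v) →
        vertex p′ (suc zero) < vertex p (suc zero) →
        Σ[ j ∈ Fin m ] Σ[ w ∈ V ]
          ( w < vertex p (inject₁ (suc j))
          × vertex p (inject₁ (inject₁ j)) ⟶ w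
          × w ⟶ vertex p (suc (suc j)) )

------------------------------------------------------------------------
-- Level posets

module LevelPoset (G : Digraph) where
  open Digraph G

  infix 4 _<_

  _<_ : Rel (V × ℤ) 0ℓ
  (u , i) < (v , j) = i ℤ.< j × Walk ∣ j ℤ.- i ∣ u v

  private
    gap-≥0 : ∀ {i j} → i ℤ.< j → + ∣ j ℤ.- i ∣ ≡ j ℤ.- i
    gap-≥0 i<j = ℤ.0≤i⇒+∣i∣≡i (ℤ.i≤j⇒0≤j-i (ℤ.<⇒≤ i<j))

    telescope : ∀ i j k → (j ℤ.- i) ℤ.+ (k ℤ.- j) ≡ k ℤ.- i
    telescope = solve-∀

    gap-+ : ∀ {i j k} → i ℤ.< j → j ℤ.< k →
            ∣ j ℤ.- i ∣ ℕ.+ ∣ k ℤ.- j ∣ ≡ ∣ k ℤ.- i ∣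
    gap-+ {i} {j} {k} i<j j<k = ℤ.+-injective (begin
      + (∣ j ℤ.- i ∣ ℕ.+ ∣ k ℤ.- j ∣)  ≡⟨ cong₂ ℤ._+_ (gap-≥0 i<j) (gap-≥0 j<k) ⟩
      (j ℤ.- i) ℤ.+ (k ℤ.- j)          ≡⟨ telescope i j k ⟩
      k ℤ.- i                          ≡⟨ sym (gap-≥0 (ℤ.<-trans i<j j<k)) ⟩
      + ∣ k ℤ.- i ∣                    ∎)
      where open ≡-Reasoning

  <-trans : Transitive _<_
  <-trans {u , i} {v , j} {w , k} (i<j , p) (j<k , q) =
    ℤ.<-trans i<j j<k , subst (λ n → Walk n u w) (gap-+ i<j j<k) (p ++ʷ q)

  levelPoset : StrictPartialOrder 0ℓ 0ℓ 0ℓ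
  levelPoset = record
    { Carrier = V × ℤ
    ; _≈_     = _≡_
    ; _<_     = _<_
    ; isStrictPartialOrder = record
      { isEquivalence = isEquivalence
      ; irrefl        = λ { refl (i<i , _) → ℤ.<-irrefl refl i<i }
      ; trans         = <-trans
      ; <-resp-≈      = resp₂ _<_
      }
    }

  open Order _<_ public

  Δ[_,_] : (x y : V × ℤ) → Pred (List (V × ℤ)) 0ℓ
  Δ[ x , y ] = OrderComplex (Interval x y) x y

  removeEnds : (x y : V × ℤ) → List (V × ℤ) → List (V × ℤ)
  removeEnds x y = filter (λ z → ¬? (z ≟ₚ x) ×-dec ¬? (z ≟ₚ y))
    where
    _≟ₚ_ : DecidableEquality (V × ℤ)
    _≟ₚ_ = ≡-dec _≟_ ℤ._≟_

  -- For a chain listed in increasing order.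
  word : List (V × ℤ) → List V
  word = map proj₁

  -- Cs is the list of all maximal chains of [x , y], each written
  -- bottom to top, in increasing lexicographic order of their words.
  record IsLexOrdering (_<ⱽ_ : Rel V 0ℓ) (x y : V × ℤ)
                       (Cs : List (List (V × ℤ))) : Set where
    field
      maximal    : All (IsMaximalChain (Interval x y)) Cs
      ascending  : All (Linked _⋖_) Cs
      complete   : ∀ {C} → IsMaximalChain (Interval x y) C → Any (C ∼[ set ]_) Cs
      increasing : AllPairs (λ C D → Lex-< _≡_ _<ⱽ_ (word C) (word D)) Cs

{-# OPTIONS --safe #-}

-- The maximal chains of an interval are the walks of the right length between its ends.
-- If the walk q precedes p lexicographically, take the stretch on which they first differ, up to
-- the next position where they meet.  The exchange property lowers a vertex of p inside that
-- stretch, at a position where p and q differ.  The resulting walk p′ precedes p, and p minus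
-- the lowered vertex is a face of codimension one that lies in p′ and contains p ∩ q.

module Submission where

open import Defs
open import Data.Fin.Base as Fin using (Fin; zero; suc; inject₁)
import Data.Fin.Properties as Fin
open import Data.Integer.Base as ℤ using (ℤ; +_; ∣_∣; 1ℤ)
import Data.Integer.Properties as ℤ
open import Data.Integer.Tactic.RingSolver using (solve-∀)
open import Data.List.Base using (List; []; _∷_; _++_; length; lookup; map; filter; concatMap; tabulate)
open import Data.List.Membership.Propositional using (_∈_; _∉_; find; lose)
open import Data.List.Membership.Propositional.Properties
  using (∈-∃++; ∈-filter⁺; ∈-filter⁻; ∈-lookup; ∈-tabulate⁺)
open import Data.List.Properties using (length-filter)
open import Data.List.Relation.Binary.BagAndSetEquality using (set; _∼[_]_)
open import Data.List.Relation.Binary.Lex.Strict using (Lex-<; base; this; next; <-asymmetric)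
open import Data.List.Relation.Binary.Permutation.Propositional.Properties
  using (shift; ∈-resp-↭; ↭-length)
import Data.List.Relation.Binary.Permutation.Setoid.Properties as Permutation
open import Data.List.Relation.Binary.Permutation.Propositional using (↭-sym; ↭⇒↭ₛ)
import Data.List.Sort as Sort
open import Data.List.Relation.Binary.Subset.Propositional using (_⊆_)
open import Data.List.Relation.Binary.Subset.Propositional.Properties using (⊆-reflexive)
open import Data.List.Relation.Unary.All as All using (All; []; _∷_)
import Data.List.Relation.Unary.All.Properties as All
open import Data.List.Relation.Unary.AllPairs as AllPairs using (AllPairs; []; _∷_)
import Data.List.Relation.Unary.AllPairs.Properties as AllPairs
open import Data.List.Relation.Unary.Any as Any using (Any; here; there)
import Data.List.Relation.Unary.Any.Properties as Any
open import Data.List.Relation.Unary.Linked as Linked using (Linked; [-]; _∷_)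
open import Data.List.Relation.Unary.Linked.Properties using (Linked⇒AllPairs)
open import Data.List.Relation.Unary.Unique.Propositional using (Unique)
import Data.List.Relation.Unary.Unique.Propositional.Properties as Unique
open import Data.Nat.Base as ℕ using (ℕ; zero; suc; s≤s; z≤n)
import Data.Nat.Properties as ℕ
open import Data.Product.Base using (Σ-syntax; ∃-syntax; _×_; _,_; proj₁; proj₂)
open import Data.Product.Properties using (≡-dec)
open import Data.Sum.Base using (_⊎_; inj₁; inj₂)
open import Function.Base using (_∘_; id)
open import Function.Bundles using (module Inverse; module Equivalence; mk⇔)
open import Level using (0ℓ)
open import Relation.Binary.Core using (Rel)
open import Relation.Binary.Definitions
  using (Irreflexive; Transitive; DecidableEquality; Tri; tri<; tri≈; tri>)
open import Relation.Binary.PropositionalEquality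
  using (_≡_; _≢_; refl; sym; trans; cong; subst; subst₂; resp₂; setoid; module ≡-Reasoning)
open import Relation.Binary.Structures using (module IsStrictTotalOrder)
open import Relation.Binary.Bundles using (StrictTotalOrder; module DecTotalOrder)
import Relation.Binary.Properties.StrictTotalOrder as StrictTotalOrder
open import Relation.Nullary.Decidable using (Dec; yes; no; ¬?)
open import Relation.Nullary.Negation using (¬_; contradiction)
open import Relation.Unary using (Pred)

-- Finite sets as lists, purity, and sorted lists.

module _ {A : Set} where

  ∼set⇒⊆ : ∀ {xs ys : List A} → xs ∼[ set ] ys → xs ⊆ ys
  ∼set⇒⊆ eq = Equivalence.to eq

  ⊆∧⊇⇒∼set : ∀ {xs ys : List A} → xs ⊆ ys → ys ⊆ xs → xs ∼[ set ] ys
  ⊆∧⊇⇒∼set xs⊆ys ys⊆xs = mk⇔ xs⊆ys ys⊆xs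

  -- Induction on `xs`: deleting one occurrence of the head of `xs` from `ys` leaves a list that
  -- still contains the tail, since the head does not recur there.
  unique∧⊆⇒length≤ : ∀ {xs ys : List A} → Unique xs → xs ⊆ ys → length xs ℕ.≤ length ys
  unique∧⊆⇒length≤ {[]}     _          _     = z≤n
  unique∧⊆⇒length≤ {x ∷ xs} (x≢ ∷ !xs) xs⊆ys with ∈-∃++ (xs⊆ys (here refl))
  ... | as , bs , refl = begin
    suc (length xs)         ≤⟨ s≤s (unique∧⊆⇒length≤ !xs xs⊆) ⟩
    suc (length (as ++ bs)) ≡⟨ ↭-length (shift x as bs) ⟨
    length (as ++ x ∷ bs)   ∎
    where
    open ℕ.≤-Reasoning
    xs⊆ : xs ⊆ as ++ bs
    xs⊆ z∈ with ∈-resp-↭ (shift x as bs) (xs⊆ys (there z∈))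
    ... | here refl = contradiction refl (All.lookup x≢ z∈)
    ... | there z∈′ = z∈′

  unique∧⊆∧⊇⇒length≡ : ∀ {xs ys : List A} → Unique xs → Unique ys → xs ⊆ ys → ys ⊆ xs →
                       length xs ≡ length ys
  unique∧⊆∧⊇⇒length≡ !xs !ys xs⊆ys ys⊆xs =
    ℕ.≤-antisym (unique∧⊆⇒length≤ !xs xs⊆ys) (unique∧⊆⇒length≤ !ys ys⊆xs)

  -- A facet has the same elements as any face around it, so it inherits the dimension `d` of its
  -- cover. The face `face₀` ensures that `d` is attained, through its own cover.
  covered⇒isPure : ∀ {Δ : Pred (List A) 0ℓ} {d} → IsSimplicialComplex Δ → ∃[ σ ] Δ σ →
                   (∀ {σ} → Δ σ → ∃[ τ ] (Δ τ × σ ⊆ τ × dim τ ≡ d)) → IsPure Δ d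
  covered⇒isPure {Δ} {d} isSimplicialComplex (_ , face₀) cover = record
    { isSimplicialComplex = isSimplicialComplex
    ; dim-attained        = attained (cover face₀)
    ; dim-bound           = λ face → bound face (cover face)
    ; facets-dim          = λ facet → facet-dim facet (cover (proj₁ facet))
    }
    where
    open IsSimplicialComplex isSimplicialComplex
    attained : ∀ {σ} → ∃[ τ ] (Δ τ × σ ⊆ τ × dim τ ≡ d) → ∃[ τ ] (Δ τ × dim τ ≡ d)
    attained (τ , Δτ , _ , eq) = τ , Δτ , eq
    bound : ∀ {σ} → Δ σ → ∃[ τ ] (Δ τ × σ ⊆ τ × dim τ ≡ d) → dim σ ℤ.≤ d
    bound face (_ , _ , σ⊆τ , refl) =
      ℤ.+-monoˡ-≤ (ℤ.- 1ℤ) (ℤ.+≤+ (unique∧⊆⇒length≤ (faces-unique face) σ⊆τ))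
    facet-dim : ∀ {σ} → IsFacet Δ σ → ∃[ τ ] (Δ τ × σ ⊆ τ × dim τ ≡ d) → dim σ ≡ d
    facet-dim (face , maximal) (_ , Δτ , σ⊆τ , refl) = cong (λ l → + l ℤ.- 1ℤ)
      (unique∧⊆∧⊇⇒length≡ (faces-unique face) (faces-unique Δτ) σ⊆τ (maximal Δτ σ⊆τ))

  module _ {R : Rel A 0ℓ} where

    AllPairs-comparable : ∀ {xs} → AllPairs R xs → ∀ {x y} → x ∈ xs → y ∈ xs →
                          (R x y ⊎ x ≡ y) ⊎ (R y x ⊎ y ≡ x)
    AllPairs-comparable (_ ∷ _)   (here refl) (here refl) = inj₁ (inj₂ refl)
    AllPairs-comparable (xR ∷ _)  (here refl) (there y∈)  = inj₁ (inj₁ (All.lookup xR y∈))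
    AllPairs-comparable (yR ∷ _)  (there x∈)  (here refl) = inj₂ (inj₁ (All.lookup yR x∈))
    AllPairs-comparable (_ ∷ xsR) (there x∈)  (there y∈)  = AllPairs-comparable xsR x∈ y∈

    AllPairs-lookup : ∀ {xs} → AllPairs R xs → ∀ {k l} → k Fin.< l → R (lookup xs k) (lookup xs l)
    AllPairs-lookup (xR ∷ _)  {zero}  {suc l} _         = All.lookup xR (∈-lookup l)
    AllPairs-lookup (_ ∷ xsR) {suc k} {suc l} (s≤s k<l) = AllPairs-lookup xsR k<l

    AllPairs-mapWith : ∀ {P : Pred A 0ℓ} {S : Rel A 0ℓ} →
                       (∀ {x y} → P x → P y → R x y → S x y) →
                       ∀ {xs} → All P xs → AllPairs R xs → AllPairs S xs
    AllPairs-mapWith f []         []         = []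
    AllPairs-mapWith f (px ∷ pxs) (xR ∷ xsR) =
      All.zipWith (λ (py , xRy) → f px py xRy) (pxs , xR) ∷ AllPairs-mapWith f pxs xsR

    -- Each head precedes the rest of its list, so two different heads would each precede the other.
    -- With equal heads, irreflexivity keeps the head out of the tails and the inclusions restrict
    -- to them.
    sorted⇒≡ : Irreflexive _≡_ R → Transitive R → ∀ {xs ys} → AllPairs R xs → AllPairs R ys →
               xs ⊆ ys → ys ⊆ xs → xs ≡ ys
    sorted⇒≡ irr tr {[]}    {[]}    _ _ _ _ = refl
    sorted⇒≡ irr tr {[]}    {_ ∷ _} _ _ _ ⊇ with () ← ⊇ (here refl)
    sorted⇒≡ irr tr {_ ∷ _} {[]}    _ _ ⊆ _ with () ← ⊆ (here refl)
    sorted⇒≡ irr tr {x ∷ xs} {y ∷ ys} (xR ∷ xsR) (yR ∷ ysR) ⊆ ⊇ = heads (⊆ (here refl)) (⊇ (here refl))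
      where
      tails : x ≡ y → x ∷ xs ≡ y ∷ ys
      tails refl = cong (x ∷_) (sorted⇒≡ irr tr xsR ysR ⊆′ ⊇′)
        where
        ⊆′ : ∀ {z} → z ∈ xs → z ∈ ys
        ⊆′ z∈ with ⊆ (there z∈)
        ... | here refl = contradiction (All.lookup xR z∈) (irr refl)
        ... | there z∈′ = z∈′
        ⊇′ : ∀ {z} → z ∈ ys → z ∈ xs
        ⊇′ z∈ with ⊇ (there z∈)
        ... | here refl = contradiction (All.lookup yR z∈) (irr refl)
        ... | there z∈′ = z∈′
      heads : x ∈ y ∷ ys → y ∈ x ∷ xs → x ∷ xs ≡ y ∷ ys
      heads (here x≡y) _          = tails x≡y
      heads (there _)  (here y≡x) = tails (sym y≡x)
      heads (there x∈) (there y∈) =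
        contradiction (tr (All.lookup yR x∈) (All.lookup xR y∈)) (irr refl)

-- Arithmetic of levels.

suc-+-comm : ∀ i k → ℤ.suc i ℤ.+ + k ≡ i ℤ.+ + suc k
suc-+-comm i k = lemma i (+ k)
  where
  lemma : ∀ i k → (1ℤ ℤ.+ i) ℤ.+ k ≡ i ℤ.+ (1ℤ ℤ.+ k)
  lemma = solve-∀

∣[i+k]-i∣≡k : ∀ i k → ∣ (i ℤ.+ + k) ℤ.- i ∣ ≡ k
∣[i+k]-i∣≡k i k = cong ∣_∣ (lemma i (+ k))
  where
  lemma : ∀ i k → (i ℤ.+ k) ℤ.- i ≡ k
  lemma = solve-∀

+-cancelˡ-+ : ∀ i {k l} → i ℤ.+ + k ≡ i ℤ.+ + l → k ≡ l
+-cancelˡ-+ i {k} {l} eq = begin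
  k                       ≡⟨ ∣[i+k]-i∣≡k i k ⟨
  ∣ i ℤ.+ + k ℤ.- i ∣     ≡⟨ cong (λ j → ∣ j ℤ.- i ∣) eq ⟩
  ∣ i ℤ.+ + l ℤ.- i ∣     ≡⟨ ∣[i+k]-i∣≡k i l ⟩
  l                       ∎
  where open ≡-Reasoning

i+∣j-i∣≡j : ∀ {i j} → i ℤ.< j → i ℤ.+ + ∣ j ℤ.- i ∣ ≡ j
i+∣j-i∣≡j {i} {j} i<j = trans
  (cong (λ k → i ℤ.+ k) (ℤ.0≤i⇒+∣i∣≡i (ℤ.i≤j⇒0≤j-i (ℤ.<⇒≤ i<j))))
  (lemma i j)
  where
  lemma : ∀ i j → i ℤ.+ (j ℤ.- i) ≡ j
  lemma = solve-∀

i<i+1+k : ∀ i k → i ℤ.< i ℤ.+ + suc k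
i<i+1+k i k = ℤ.suc[i]≤j⇒i<j (subst (ℤ.suc i ℤ.≤_) (suc-+-comm i k) (ℤ.i≤i+j (ℤ.suc i) (+ k)))

-- Walks and their points in the level poset.

module _ (G : Digraph) where
  open Digraph G
  open LevelPoset G

  private
    variable
      k l m : ℕ
      u v w u′ v′ : V
      x y z : V × ℤ

  <-irrefl : ¬ (x < x)
  <-irrefl (i<i , _) = ℤ.<-irrefl refl i<i

  _≟ₚ_ : DecidableEquality (V × ℤ)
  _≟ₚ_ = ≡-dec _≟_ ℤ._≟_

  AllPairs<⇒Unique : ∀ {xs} → AllPairs _<_ xs → Unique xs
  AllPairs<⇒Unique = AllPairs.map λ { x<y refl → <-irrefl x<y }

  infix 4 _⟿_
  -- A form of `x ≤ y` with an explicit number of steps, zero allowed. It treats equality and strict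
  -- order alike and lets walks be concatenated without absolute values of level differences.
  record _⟿_ (x y : V × ℤ) : Set where
    constructor via
    field
      {steps}   : ℕ
      level-gap : proj₂ x ℤ.+ + steps ≡ proj₂ y
      walk      : Walk steps (proj₁ x) (proj₁ y)

  walk⇒< : ∀ {i j} → i ℤ.+ + suc k ≡ j → Walk (suc k) u v → (u , i) < (v , j)
  walk⇒< {k} {u} {v} {i} refl p =
    i<i+1+k i k , subst (λ n → Walk n u v) (sym (∣[i+k]-i∣≡k i (suc k))) p

  ⟿⇒≤ : x ⟿ y → x ≤ y
  ⟿⇒≤ (via eq [])        = inj₂ (cong (_ ,_) (trans (sym (ℤ.+-identityʳ _)) eq))
  ⟿⇒≤ (via eq p@(_ ∷ _)) = inj₁ (walk⇒< eq p)

  ≤⇒⟿ : x ≤ y → x ⟿ y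
  ≤⇒⟿ (inj₁ (i<j , p)) = via (i+∣j-i∣≡j i<j) p
  ≤⇒⟿ (inj₂ refl)      = via (ℤ.+-identityʳ _) []

  ≤⇒level≤ : x ≤ y → proj₂ x ℤ.≤ proj₂ y
  ≤⇒level≤ (inj₁ (i<j , _)) = ℤ.<⇒≤ i<j
  ≤⇒level≤ (inj₂ refl)      = ℤ.≤-refl

  -- Splitting off `later` exposes the head of `points i p` without a case distinction on `p`.
  points later : ℤ → Walk k u v → List (V × ℤ)
  points {u = u} i p = (u , i) ∷ later i p
  later i []      = []
  later i (_ ∷ p) = points (ℤ.suc i) p

  points-below : ∀ {i} (p : Walk k u v) → z ∈ points i p → (u , i) ⟿ z
  points-below p       (here refl) = via (ℤ.+-identityʳ _) []
  points-below {i = i} (e ∷ p) (there z∈) with via {k} eq q ← points-below p z∈ =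
    via (trans (sym (suc-+-comm i k)) eq) (e ∷ q)

  points-above : ∀ {i} (p : Walk k u v) → z ∈ points i p → z ⟿ (v , i ℤ.+ + k)
  points-above p (here refl) = via refl p
  points-above {suc k} {v = v} {i = i} (e ∷ p) (there z∈) =
    subst (λ j → _ ⟿ (v , j)) (suc-+-comm i k) (points-above p z∈)

  later-above : ∀ {i} (p : Walk k u v) → z ∈ later i p → (u , i) < z
  later-above {i = i} (e ∷ p) z∈ with via {k} eq q ← points-below p z∈ =
    walk⇒< (trans (sym (suc-+-comm i k)) eq) (e ∷ q)

  points-sorted : ∀ i (p : Walk k u v) → AllPairs _<_ (points i p)
  points-sorted i []          = [] ∷ []
  points-sorted i p@(_ ∷ p′)  = All.tabulate (later-above p) ∷ points-sorted (ℤ.suc i) p′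

  points-last : ∀ i (p : Walk k u v) → (v , i ℤ.+ + k) ∈ points i p
  points-last i [] = here (cong (_ ,_) (ℤ.+-identityʳ i))
  points-last {suc k} {v = v} i (e ∷ p) =
    there (subst (λ j → (v , j) ∈ points (ℤ.suc i) p) (suc-+-comm i k) (points-last (ℤ.suc i) p))

  length-points : ∀ i (p : Walk k u v) → length (points i p) ≡ suc k
  length-points i []      = refl
  length-points i (e ∷ p) = cong suc (length-points (ℤ.suc i) p)

  -- One inclusion is enough because both walks have length `k` and a single point on each level:
  -- the start of `p` can only be the start of `q`, as all later points of `q` lie on higher levels.
  points-injective : ∀ {i} (p : Walk k u v) (q : Walk k u′ v′) →
                     points i p ⊆ points i q → points i p ≡ points i q
  points-injective p q p⊆q with p⊆q (here refl)
  points-injective p q p⊆q | there u∈ = contradiction (proj₁ (later-above q u∈)) (ℤ.<-irrefl refl)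
  points-injective []      []      p⊆q | here refl = refl
  points-injective {u = u} {i = i} (e ∷ p) (f ∷ q) p⊆q | here refl = cong ((u , i) ∷_) (points-injective p q tails)
    where
    tails : points _ p ⊆ points _ q
    tails z∈ with p⊆q (there z∈)
    ... | there z∈′ = z∈′
    ... | here refl = contradiction (proj₁ (later-above (e ∷ p) z∈)) (ℤ.<-irrefl refl)

  points-++ˡ : ∀ {i} (p : Walk k u v) (q : Walk l v w) → points i p ⊆ points i (p ++ʷ q)
  points-++ˡ []      q (here refl) = here refl
  points-++ˡ (e ∷ p) q (here refl) = here refl
  points-++ˡ (e ∷ p) q (there z∈)  = there (points-++ˡ p q z∈)

  points-++ʳ : ∀ {i} (p : Walk k u v) (q : Walk l v w) →
               points (i ℤ.+ + k) q ⊆ points i (p ++ʷ q)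
  points-++ʳ {i = i} []      q rewrite ℤ.+-identityʳ i = id
  points-++ʳ {suc k} {i = i} (e ∷ p) q rewrite sym (suc-+-comm i k) = there ∘ points-++ʳ p q

  trace : x ⟿ y → List (V × ℤ)
  trace {x} (via _ p) = points (proj₂ x) p

  ⟿-trans : x ⟿ y → y ⟿ z → x ⟿ z
  ⟿-trans {_ , i} (via {k} refl p) (via {l} refl q) = via (sym (ℤ.+-assoc i (+ k) (+ l))) (p ++ʷ q)

  trace-⟿-transˡ : (r : x ⟿ y) (s : y ⟿ z) → trace r ⊆ trace (⟿-trans r s)
  trace-⟿-transˡ (via refl p) (via refl q) = points-++ˡ p q

  trace-⟿-transʳ : (r : x ⟿ y) (s : y ⟿ z) → trace s ⊆ trace (⟿-trans r s)
  trace-⟿-transʳ (via refl p) (via refl q) = points-++ʳ p q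

  -- Quicksort on levels: the first element of C is the pivot, and m bounds the recursion.
  cover : ∀ m (C : List (V × ℤ)) → length C ℕ.≤ m →
          (∀ {a b} → a ∈ C → b ∈ C → a ≤ b ⊎ b ≤ a) →
          (∀ {c} → c ∈ C → x ≤ c × c ≤ y) →
          x ⟿ y → Σ[ r ∈ x ⟿ y ] C ⊆ trace r
  cover m       []      _         comp inside r = r , λ ()
  cover {x = x} {y} (suc m) (c ∷ C) (s≤s ∣C∣≤m) comp inside _ = ⟿-trans r s , covers
    where
    lower? = λ (z : V × ℤ) → proj₂ z ℤ.≤? proj₂ c
    upper? = λ (z : V × ℤ) → proj₂ c ℤ.≤? proj₂ z
    lo = filter lower? C
    hi = filter upper? C

    -- Elements on the level of `c` enter both `lo` and `hi`. This is harmless: being comparable to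
    -- `c`, they equal `c`.
    lo≤c : ∀ {z} → z ∈ lo → z ≤ c
    lo≤c z∈ with z∈C , z≤c ← ∈-filter⁻ lower? {xs = C} z∈ with comp (there z∈C) (here refl)
    ... | inj₁ z≤c         = z≤c
    ... | inj₂ (inj₂ refl) = inj₂ refl
    ... | inj₂ (inj₁ c<z)  = contradiction (proj₁ c<z) (ℤ.≤⇒≯ z≤c)

    c≤hi : ∀ {z} → z ∈ hi → c ≤ z
    c≤hi z∈ with z∈C , c≤z ← ∈-filter⁻ upper? {xs = C} z∈ with comp (here refl) (there z∈C)
    ... | inj₁ c≤z         = c≤z
    ... | inj₂ (inj₂ refl) = inj₂ refl
    ... | inj₂ (inj₁ z<c)  = contradiction (proj₁ z<c) (ℤ.≤⇒≯ c≤z)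

    lo⊆ : ∀ {z} → z ∈ lo → z ∈ c ∷ C
    lo⊆ z∈ = there (proj₁ (∈-filter⁻ lower? {xs = C} z∈))

    hi⊆ : ∀ {z} → z ∈ hi → z ∈ c ∷ C
    hi⊆ z∈ = there (proj₁ (∈-filter⁻ upper? {xs = C} z∈))

    low = cover m lo (ℕ.≤-trans (length-filter lower? C) ∣C∣≤m)
      (λ a∈ b∈ → comp (lo⊆ a∈) (lo⊆ b∈)) (λ z∈ → proj₁ (inside (lo⊆ z∈)) , lo≤c z∈)
      (≤⇒⟿ (proj₁ (inside (here refl))))
    high = cover m hi (ℕ.≤-trans (length-filter upper? C) ∣C∣≤m)
      (λ a∈ b∈ → comp (hi⊆ a∈) (hi⊆ b∈)) (λ z∈ → c≤hi z∈ , proj₂ (inside (hi⊆ z∈)))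
      (≤⇒⟿ (proj₂ (inside (here refl))))

    r : x ⟿ c
    r = proj₁ low
    s : c ⟿ y
    s = proj₁ high

    covers : c ∷ C ⊆ trace (⟿-trans r s)
    covers (here refl) = trace-⟿-transʳ r s (here refl)
    covers {z} (there z∈) with ℤ.≤-total (proj₂ z) (proj₂ c)
    ... | inj₁ z≤c = trace-⟿-transˡ r s (proj₂ low (∈-filter⁺ lower? z∈ z≤c))
    ... | inj₂ c≤z = trace-⟿-transʳ r s (proj₂ high (∈-filter⁺ upper? z∈ c≤z))

  edge-⋖ : ∀ {i} → u ⟶ v → (u , i) ⋖ (v , ℤ.suc i)
  edge-⋖ {i = i} e =
    walk⇒< (ℤ.+-comm i 1ℤ) (e ∷ []) ,
    λ { (_ , (i<j , _) , (j<1+i , _)) → ℤ.≤⇒≯ (ℤ.i<j⇒suc[i]≤j i<j) j<1+i }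

  points-linked : ∀ i (p : Walk k u v) → Linked _⋖_ (points i p)
  points-linked i []      = [-]
  points-linked i (e ∷ p) = edge-⋖ e ∷ points-linked (ℤ.suc i) p

  -- Maximal chains and facets of an interval as walks.

  module Between {u v : V} (i : ℤ) {n : ℕ} (p₀ : Walk (suc n) u v) where

    private
      0̂ 1̂ : V × ℤ
      0̂ = u , i
      1̂ = v , i ℤ.+ + suc n

    inner : Walk (suc n) u v → List (V × ℤ)
    inner p = removeEnds 0̂ 1̂ (points i p)

    ∈-removeEnds⁺ : ∀ {C} → z ∈ C → z ≢ 0̂ → z ≢ 1̂ → z ∈ removeEnds 0̂ 1̂ C
    ∈-removeEnds⁺ z∈ z≢0̂ z≢1̂ = ∈-filter⁺ _ z∈ (z≢0̂ , z≢1̂)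

    ∈-removeEnds⁻ : ∀ {C} → z ∈ removeEnds 0̂ 1̂ C → z ∈ C × z ≢ 0̂ × z ≢ 1̂
    ∈-removeEnds⁻ z∈ = ∈-filter⁻ _ z∈

    ∈-inner⁺ : ∀ p → z ∈ points i p → z ≢ 0̂ → z ≢ 1̂ → z ∈ inner p
    ∈-inner⁺ p = ∈-removeEnds⁺

    ∈-inner⁻ : ∀ p → z ∈ inner p → z ∈ points i p × z ≢ 0̂ × z ≢ 1̂
    ∈-inner⁻ p = ∈-removeEnds⁻

    inner-unique : ∀ p → Unique (inner p)
    inner-unique p = removeEnds-unique (AllPairs<⇒Unique (points-sorted i p))
      where
      removeEnds-unique : ∀ {C} → Unique C → Unique (removeEnds 0̂ 1̂ C)
      removeEnds-unique = Unique.filter⁺ _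

    points-isChain : ∀ p → IsChain (Interval 0̂ 1̂) (points i p)
    points-isChain p = record
      { unique     = AllPairs<⇒Unique (points-sorted i p)
      ; inside     = λ z∈ → ⟿⇒≤ (points-below p z∈) , ⟿⇒≤ (points-above p z∈)
      ; comparable = AllPairs-comparable (points-sorted i p)
      }

    chain⊆points : ∀ {C} → IsChain (Interval 0̂ 1̂) C → Σ[ p ∈ Walk (suc n) u v ] C ⊆ points i p
    chain⊆points {C} isChain
      with cover (length C) C ℕ.≤-refl (IsChain.comparable isChain) (IsChain.inside isChain)
             (via refl p₀)
    -- The levels of the two ends determine the number of steps, so the walk found has length
    -- `suc n`.
    ... | via eq p , C⊆p with refl ← +-cancelˡ-+ i eq = p , C⊆p

    -- A chain containing `points i p` lies in some `points i q`, and one inclusion between the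
    -- points of two walks already makes them equal.
    points-maximal : ∀ p → IsMaximalChain (Interval 0̂ 1̂) (points i p)
    points-maximal p = points-isChain p , λ {D} isChain p⊆D →
      let q , D⊆q = chain⊆points isChain
      in subst (D ⊆_) (sym (points-injective p q (D⊆q ∘ p⊆D))) D⊆q

    maximal⇒⊇points : ∀ {C} → IsMaximalChain (Interval 0̂ 1̂) C →
                      Σ[ p ∈ Walk (suc n) u v ] (C ⊆ points i p × points i p ⊆ C)
    maximal⇒⊇points (isChain , maximal) =
      let p , C⊆p = chain⊆points isChain in p , C⊆p , maximal (points-isChain p) C⊆p

    maximal⇒points : ∀ {C} → IsMaximalChain (Interval 0̂ 1̂) C → Linked _⋖_ C →
                     Σ[ p ∈ Walk (suc n) u v ] C ≡ points i p
    maximal⇒points maximal linked =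
      let p , C⊆p , p⊆C = maximal⇒⊇points maximal
      in p , sorted⇒≡ (λ { refl → <-irrefl }) <-trans
               (Linked⇒AllPairs <-trans (Linked.map proj₁ linked)) (points-sorted i p) C⊆p p⊆C

    face⊆inner : ∀ {σ} → Δ[ 0̂ , 1̂ ] σ → ∃[ p ] σ ⊆ inner p
    face⊆inner face =
      let p , σ⊆p = chain⊆points (record
            { unique     = unique
            ; inside     = proj₁ ∘ inside
            ; comparable = comparable
            })
      in p , λ z∈ → let _ , z≢0̂ , z≢1̂ = inside z∈ in ∈-removeEnds⁺ (σ⊆p z∈) z≢0̂ z≢1̂
      where open IsChain face

    inner-face : ∀ p → Δ[ 0̂ , 1̂ ] (inner p)
    inner-face p = record
      { unique     = inner-unique p
      ; inside     = λ z∈ → let z∈p , z≢ = ∈-removeEnds⁻ z∈ in inside z∈p , z≢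
      ; comparable = λ x∈ y∈ → comparable (proj₁ (∈-removeEnds⁻ x∈)) (proj₁ (∈-removeEnds⁻ y∈))
      }
      where open IsChain (points-isChain p)

    -- Both walks pass through `0̂` and `1̂`, so putting the ends back extends the inclusion to all
    -- points. Thus a facet determines the points of its walk.
    inner⊆⇒points≡ : ∀ p q → inner p ⊆ inner q → points i p ≡ points i q
    inner⊆⇒points≡ p q p⊆q = points-injective p q ⊆′
      where
      ⊆′ : points i p ⊆ points i q
      ⊆′ {z} z∈ with z ≟ₚ 0̂ | z ≟ₚ 1̂
      ... | yes refl | _        = here refl
      ... | no _     | yes refl = points-last i q
      ... | no z≢0̂   | no z≢1̂   = proj₁ (∈-removeEnds⁻ (p⊆q (∈-removeEnds⁺ z∈ z≢0̂ z≢1̂)))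

    inner-facet : ∀ p → IsFacet Δ[ 0̂ , 1̂ ] (inner p)
    inner-facet p = inner-face p , λ {τ} face p⊆τ →
      let q , τ⊆q = face⊆inner face
      in subst (λ C → τ ⊆ removeEnds 0̂ 1̂ C) (sym (inner⊆⇒points≡ p q (τ⊆q ∘ p⊆τ))) τ⊆q

    facet⇒inner : ∀ {σ} → IsFacet Δ[ 0̂ , 1̂ ] σ → ∃[ p ] (σ ⊆ inner p × inner p ⊆ σ)
    facet⇒inner (face , maximal) =
      let p , σ⊆p = face⊆inner face in p , σ⊆p , maximal (inner-face p) σ⊆p

    0̂≢1̂ : 0̂ ≢ 1̂
    0̂≢1̂ eq = ℤ.<-irrefl (cong proj₂ eq) (i<i+1+k i n)

    -- A walk of length `suc n` has `suc (suc n)` points, and exactly the two distinct ends are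
    -- removed.
    length-inner : ∀ p → length (inner p) ≡ n
    length-inner p = ℕ.suc-injective (ℕ.suc-injective (trans
      (unique∧⊆∧⊇⇒length≡ unique (AllPairs<⇒Unique (points-sorted i p)) ⊆′ ⊇′)
      (length-points i p)))
      where
      unique : Unique (0̂ ∷ 1̂ ∷ inner p)
      unique =
        (0̂≢1̂ ∷ All.tabulate λ { z∈ refl → proj₁ (proj₂ (∈-removeEnds⁻ z∈)) refl }) ∷
        All.tabulate (λ { z∈ refl → proj₂ (proj₂ (∈-removeEnds⁻ z∈)) refl }) ∷
        inner-unique p
      ⊆′ : 0̂ ∷ 1̂ ∷ inner p ⊆ points i p
      ⊆′ (here refl)         = here refl
      ⊆′ (there (here refl)) = points-last i p
      ⊆′ (there (there z∈))  = proj₁ (∈-removeEnds⁻ z∈)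
      ⊇′ : points i p ⊆ 0̂ ∷ 1̂ ∷ inner p
      ⊇′ {z} z∈ with z ≟ₚ 0̂ | z ≟ₚ 1̂
      ... | yes z≡0̂ | _       = here z≡0̂
      ... | no _    | yes z≡1̂ = there (here z≡1̂)
      ... | no z≢0̂  | no z≢1̂  = there (there (∈-removeEnds⁺ z∈ z≢0̂ z≢1̂))

    -- For `z` in `inner p`, this is the codimension-one face of the facet opposite to the vertex
    -- `z`.
    ridge : Walk (suc n) u v → V × ℤ → List (V × ℤ)
    ridge p z = filter (λ y → ¬? (y ≟ₚ z)) (inner p)

    ∈-ridge⁺ : ∀ p z {y} → y ∈ inner p → y ≢ z → y ∈ ridge p z
    ∈-ridge⁺ p z = ∈-filter⁺ (λ y → ¬? (y ≟ₚ z))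

    ∈-ridge⁻ : ∀ p z {y} → y ∈ ridge p z → y ∈ inner p × y ≢ z
    ∈-ridge⁻ p z = ∈-filter⁻ (λ y → ¬? (y ≟ₚ z)) {xs = inner p}

    ridge-unique : ∀ p z → Unique (ridge p z)
    ridge-unique p z = Unique.filter⁺ (λ y → ¬? (y ≟ₚ z)) (inner-unique p)

    length-ridge : ∀ p z → z ∈ inner p → suc (length (ridge p z)) ≡ n
    length-ridge p z z∈ = trans
      (unique∧⊆∧⊇⇒length≡ unique (inner-unique p) ⊆′ ⊇′)
      (length-inner p)
      where
      unique : Unique (z ∷ ridge p z)
      unique = All.tabulate (λ y∈ z≡y → proj₂ (∈-ridge⁻ p z y∈) (sym z≡y)) ∷ ridge-unique p z
      ⊆′ : z ∷ ridge p z ⊆ inner p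
      ⊆′ (here refl) = z∈
      ⊆′ (there y∈)  = proj₁ (∈-ridge⁻ p z y∈)
      ⊇′ : inner p ⊆ z ∷ ridge p z
      ⊇′ {y} y∈ with y ≟ₚ z
      ... | yes y≡z = here y≡z
      ... | no y≢z  = there (∈-ridge⁺ p z y∈ y≢z)

    Δ-isPure : IsPure Δ[ 0̂ , 1̂ ] (+ n ℤ.- 1ℤ)
    Δ-isPure = covered⇒isPure
      (record
        { faces-unique = IsChain.unique
        ; down-closed  = λ face !τ τ⊆σ → let open IsChain face in record
          { unique     = !τ
          ; inside     = inside ∘ τ⊆σ
          ; comparable = λ x∈ y∈ → comparable (τ⊆σ x∈) (τ⊆σ y∈)
          }
        })
      (inner p₀ , inner-face p₀)
      λ face → let p , σ⊆p = face⊆inner face in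
        inner p , inner-face p , σ⊆p , cong (λ l → + l ℤ.- 1ℤ) (length-inner p)

  -- Lowering a vertex of a walk.

  module _ (_<ⱽ_ : Rel V 0ℓ) where

    infix 4 _<ˡ_
    _<ˡ_ : Rel (List (V × ℤ)) 0ℓ
    C <ˡ D = Lex-< _≡_ _<ⱽ_ (word C) (word D)

    private
      variable
        a b c : V

    -- p′ is p with one interior vertex lowered, at a position where p and q differ.
    data Lowered : Walk k u v → Walk k u v → Walk k u′ v′ → Set where
      here  : ∀ {e : u ⟶ a} {f : a ⟶ w} {e′ : u ⟶ b} {f′ : b ⟶ w} {r : Walk k w v}
                {w′} {g : u′ ⟶ c} {h : c ⟶ w′} {s : Walk k w′ v′} →
              b <ⱽ a → c ≢ a → Lowered (e ∷ f ∷ r) (e′ ∷ f′ ∷ r) (g ∷ h ∷ s)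
      there : ∀ {p p′ : Walk k a v} {q : Walk k b v′} {e : u ⟶ a} {f : u′ ⟶ b} →
              Lowered p p′ q → Lowered (e ∷ p) (e ∷ p′) (f ∷ q)

    Lowered-++ʷ : ∀ {p p′ : Walk k u v} {q : Walk k u′ v′} {r : Walk l v w} {w′} {s : Walk l v′ w′} →
                  Lowered p p′ q → Lowered (p ++ʷ r) (p′ ++ʷ r) (q ++ʷ s)
    Lowered-++ʷ (here b<a c≢a) = here b<a c≢a
    Lowered-++ʷ (there low)    = there (Lowered-++ʷ low)

    -- The index follows `exchange`: `j` stands for the interior position `suc j`. There `b`
    -- replaces the vertex of `p`, the two given edges replace those around it, and the rest of `p`
    -- is kept.
    lower-at : ∀ (p : Walk (suc m) u v) (q : Walk (suc m) u′ v′) (j : Fin m) →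
               b <ⱽ vertex p (inject₁ (suc j)) →
               vertex p (inject₁ (inject₁ j)) ⟶ b → b ⟶ vertex p (suc (suc j)) →
               vertex q (inject₁ (suc j)) ≢ vertex p (inject₁ (suc j)) →
               ∃[ p′ ] Lowered p p′ q
    lower-at (e ∷ f ∷ r) (g ∷ h ∷ s) zero b<a e′ f′ c≢a = (e′ ∷ f′ ∷ r) , here b<a c≢a
    lower-at (e ∷ p@(_ ∷ _)) (g ∷ q) (suc j) b<a e′ f′ c≢a =
      let p′ , low = lower-at p q j b<a e′ f′ c≢a in e ∷ p′ , there low

    -- Indexing by concatenations lets a match on `meet` split both walks at once. The positions
    -- `inject₁ j` are those strictly before the common vertex `c`.
    data FirstMeeting : Walk k u w → Walk k v w → Set where
      meet : ∀ (p : Walk m a c) (q : Walk m b c) {r s : Walk l c w} →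
             (∀ j → vertex q (inject₁ j) ≢ vertex p (inject₁ j)) →
             FirstMeeting (p ++ʷ r) (q ++ʷ s)

    -- The search succeeds because both walks have length `k` and end at `w`, where they meet at the
    -- latest.
    firstMeeting : (p : Walk k u w) (q : Walk k v w) → FirstMeeting p q
    firstMeeting {u = u} {v = v} p q with v ≟ u
    firstMeeting p       q       | yes refl = meet [] [] λ ()
    firstMeeting []      []      | no v≢u   = contradiction refl v≢u
    firstMeeting (e ∷ p) (f ∷ q) | no v≢u with firstMeeting p q
    ... | meet p₁ q₁ q≢p = meet (e ∷ p₁) (f ∷ q₁) λ { zero → v≢u ; (suc j) → q≢p j }

    Lowered⇒<ˡ : ∀ i {p p′ : Walk k u v} {q : Walk k u′ v′} →
                 Lowered p p′ q → points i p′ <ˡ points i p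
    Lowered⇒<ˡ i (here b<a _) = next refl (this b<a)
    Lowered⇒<ˡ i (there low)  = next refl (Lowered⇒<ˡ (ℤ.suc i) low)

    -- The witness `z` is the point of `p` whose vertex is lowered. `q` has only one point on that
    -- level, and its vertex differs from that of `z`.
    Lowered⇒points : ∀ i {p p′ : Walk k u v} {q : Walk k u′ v′} → Lowered p p′ q →
                     ∃[ z ] (z ∈ points i p × z ∉ points i q ×
                             (∀ {y} → y ∈ points i p → y ≢ z → y ∈ points i p′))
    Lowered⇒points i (here {a = a} {c = c} {h = h} {s = s} _ c≢a) =
      (a , ℤ.suc i) , there (here refl) , ∉q , kept
      where
      ∉q : (a , ℤ.suc i) ∉ _
      ∉q (here eq)            = ℤ.i≢suc[i] (sym (cong proj₂ eq))
      ∉q (there (here eq))    = c≢a (sym (cong proj₁ eq))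
      ∉q (there (there z∈))   = ℤ.<-irrefl refl (proj₁ (later-above (h ∷ s) z∈))
      kept : ∀ {y} → y ∈ _ → y ≢ (a , ℤ.suc i) → y ∈ _
      kept (here eq)          _   = here eq
      kept (there (here eq))  y≢z = contradiction eq y≢z
      kept (there (there y∈)) _   = there (there y∈)
    Lowered⇒points i (there {p = p} {q = q} {e = e} low)
      with z , z∈ , z∉ , kept ← Lowered⇒points (ℤ.suc i) low =
      z , there z∈ ,
      (λ { (here refl) → ℤ.<-irrefl refl (proj₁ (later-above (e ∷ p) z∈))
         ; (there z∈′) → z∉ z∈′ }) ,
      λ { (here eq) _ → here eq ; (there y∈) y≢z → there (kept y∈ y≢z) }

    module _ (shelling : IsVertexShellingOrder _<ⱽ_) where
      open IsVertexShellingOrder shelling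
      private module <ⱽ = IsStrictTotalOrder isStrictTotalOrder

      <ˡ-asym : ∀ C D → C <ˡ D → ¬ (D <ˡ C)
      <ˡ-asym C D = <-asymmetric sym (resp₂ _<ⱽ_) <ⱽ.asym

      <ˡ-irrefl : ∀ C → ¬ (C <ˡ C)
      <ˡ-irrefl C C<C = <ˡ-asym C C C<C C<C

      -- The exchange property applies to the stretch of p and q that starts just before
      -- their first difference and ends at the next vertex they share.
      <ˡ⇒Lowered : ∀ i (p q : Walk k u v) → points i q <ˡ points i p → ∃[ p′ ] Lowered p p′ q
      <ˡ⇒Lowered i p       q       (this u<u) = contradiction u<u (<ⱽ.irrefl refl)
      <ˡ⇒Lowered i []      []      (next _ (base ()))
      <ˡ⇒Lowered i (e ∷ p) (f ∷ q) (next _ (next refl q<p)) =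
        let p′ , low = <ˡ⇒Lowered (ℤ.suc i) p q (next refl q<p) in e ∷ p′ , there low
      <ˡ⇒Lowered i (e ∷ p) (f ∷ q) (next _ (this b<a)) with firstMeeting p q
      ... | meet p₁ q₁ {r = r} q≢p =
        -- Prefixing `e` and `f` gives both walks the common start that `exchange` demands. Position
        -- `suc j` of `e ∷ p₁` is position `j` of `p₁`, before the meeting vertex, so `q≢p j`
        -- supplies the required difference.
        let j , _ , w<p , e′ , f′ = exchange (e ∷ p₁) (f ∷ q₁) b<a
            p′ , low = lower-at (e ∷ p₁) (f ∷ q₁) j w<p e′ f′ (q≢p j)
        in p′ ++ʷ r , Lowered-++ʷ low


      -- Enumeration of walks in lexicographic order.

      private
        strictTotalOrder : StrictTotalOrder 0ℓ 0ℓ 0ℓ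
        strictTotalOrder = record { isStrictTotalOrder = isStrictTotalOrder }

        module ≤ⱽ = DecTotalOrder (StrictTotalOrder.decTotalOrder strictTotalOrder)
        open Sort (StrictTotalOrder.decTotalOrder strictTotalOrder) using (sort; sort-↭; sort-↗)

      vertices : List V
      vertices = sort (tabulate (Inverse.from finite))

      ∈-vertices : ∀ v → v ∈ vertices
      ∈-vertices v = ∈-resp-↭ (↭-sym (sort-↭ _))
        (subst (_∈ tabulate (Inverse.from finite)) (Inverse.strictlyInverseʳ finite v)
          (∈-tabulate⁺ {f = Inverse.from finite} (Inverse.to finite v)))

      -- Sorting yields only the weak order; injectivity of the enumeration of `V` excludes
      -- repetitions and makes it strict.
      vertices-sorted : AllPairs _<ⱽ_ vertices
      vertices-sorted = AllPairs.zipWith strict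
        ( Linked⇒AllPairs ≤ⱽ.trans (sort-↗ _)
        , Permutation.Unique-resp-↭ (setoid V) (↭⇒↭ₛ (↭-sym (sort-↭ _)))
            (Unique.tabulate⁺ from-injective) )
        where
        strict : ∀ {a b} → a ≤ⱽ.≤ b × a ≢ b → a <ⱽ b
        strict (inj₁ a<b , _)   = a<b
        strict (inj₂ a≡b , a≢b) = contradiction a≡b a≢b
        from-injective : ∀ {k l} → Inverse.from finite k ≡ Inverse.from finite l → k ≡ l
        from-injective {k} {l} eq = trans (sym (Inverse.strictlyInverseˡ finite k))
          (trans (cong (Inverse.to finite) eq) (Inverse.strictlyInverseˡ finite l))

      -- The decision is an argument so that proofs about `walks` can match on it directly.
      extend : Dec (u ⟶ v) → List (Walk k v w) → List (Walk (suc k) u w)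
      extend (yes e) ps = map (e ∷_) ps
      extend (no _)  ps = []

      walks : ∀ k u w → List (Walk k u w)
      walks zero u w with u ≟ w
      ... | yes refl = [] ∷ []
      ... | no _     = []
      walks (suc k) u w = concatMap (λ v → extend (u ⟶? v) (walks k v w)) vertices

      -- Completeness holds up to points and not up to equality of walks: the edge proof found by
      -- `_⟶?_` may differ from the one in `p`.
      walks-complete : ∀ i (p : Walk k u w) → Any (λ q → points i p ≡ points i q) (walks k u w)
      walks-complete {u = u} i [] with u ≟ u
      ... | yes refl = here refl
      ... | no u≢u   = contradiction refl u≢u
      walks-complete {suc k} {u} {w} i (_∷_ {v = v} e p) =
        Any.concatMap⁺ (λ v → extend (u ⟶? v) (walks k v w))
          (Any.map (λ { refl → extended (u ⟶? v) }) (∈-vertices v))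
        where
        extended : (u⟶?v : Dec (u ⟶ v)) →
                   Any (λ q → points i (e ∷ p) ≡ points i q) (extend u⟶?v (walks k v w))
        extended (yes _)  = Any.map⁺ (Any.map (cong ((u , i) ∷_)) (walks-complete (ℤ.suc i) p))
        extended (no ¬e)  = contradiction e ¬e

      -- The walks come in blocks according to their second vertex. Inside a block the order comes
      -- from induction, between blocks from the order of `vertices`.
      walks-sorted : ∀ i k u w → AllPairs (λ p q → points i p <ˡ points i q) (walks k u w)
      walks-sorted i zero u w with u ≟ w
      ... | yes refl = [] ∷ []
      ... | no _     = []
      walks-sorted i (suc k) u w = AllPairs.concat⁺
        (All.map⁺ (All.universal (λ v → same-head (u ⟶? v)) vertices))
        (AllPairs.map⁺ (AllPairs.map (distinct-heads (u ⟶? _) (u ⟶? _)) vertices-sorted))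
        where
        same-head : (u⟶?v : Dec (u ⟶ v)) →
                    AllPairs (λ p q → points i p <ˡ points i q) (extend u⟶?v (walks k v w))
        same-head (yes _) = AllPairs.map⁺ (AllPairs.map (next refl) (walks-sorted (ℤ.suc i) k _ w))
        same-head (no _)  = []

        distinct-heads : (u⟶?a : Dec (u ⟶ a)) (u⟶?b : Dec (u ⟶ b)) → a <ⱽ b →
                         All (λ p → All (λ q → points i p <ˡ points i q) (extend u⟶?b (walks k b w)))
                             (extend u⟶?a (walks k a w))
        distinct-heads (yes _) (yes _) a<b = All.map⁺ (All.universal
          (λ _ → All.map⁺ (All.universal (λ _ → next refl (this a<b)) _)) _)
        distinct-heads (yes _) (no _)  a<b = All.universal (λ _ → []) _
        distinct-heads (no _)  _       a<b = []

      -- The shelling of the order complex.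

      module _ {u v : V} (i : ℤ) {n : ℕ} (p₀ : Walk (suc n) u v) where
        open Between i p₀

        private
          0̂ 1̂ : V × ℤ
          0̂ = u , i
          1̂ = v , i ℤ.+ + suc n

        -- This existence result keeps the claim about all lexicographic orderings from being
        -- vacuous.
        lexOrdering : IsLexOrdering _<ⱽ_ 0̂ 1̂ (map (points i) (walks (suc n) u v))
        lexOrdering = record
          { maximal    = All.map⁺ (All.universal points-maximal _)
          ; ascending  = All.map⁺ (All.universal (points-linked i) _)
          ; complete   = λ maximal → let p , C⊆p , p⊆C = maximal⇒⊇points maximal in
              Any.map (λ p≡q {_} → ⊆∧⊇⇒∼set (⊆-reflexive p≡q ∘ C⊆p) (p⊆C ∘ ⊆-reflexive (sym p≡q)))
                (Any.map⁺ (walks-complete i p))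
          ; increasing = AllPairs.map⁺ (walks-sorted i (suc n) u v)
          }

        SharedRidge : (p p′ q : Walk (suc n) u v) → Set
        SharedRidge p p′ q = ∃[ τ ]
          ( Unique τ × τ ⊆ inner p × τ ⊆ inner p′
          × (∀ {y} → y ∈ inner p → y ∈ inner q → y ∈ τ)
          × suc (length τ) ≡ n )

        Lowered⇒ridge : ∀ {p p′ q} → Lowered p p′ q → SharedRidge p p′ q
        Lowered⇒ridge {p} {p′} {q} low with Lowered⇒points i low
        ... | z , z∈p , z∉q , kept =
            ridge p z
          , ridge-unique p z
          , proj₁ ∘ ∈-ridge⁻ p z
          , ridge⊆p′
          , (λ {y} y∈p y∈q → ∈-ridge⁺ p z y∈p
              (λ y≡z → z∉q (subst (_∈ points i q) y≡z (proj₁ (∈-inner⁻ q y∈q)))))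
          -- `q` passes through both ends of the interval but misses `z`, so `z` is neither end.
          , length-ridge p z (∈-inner⁺ p z∈p
              (λ z≡0̂ → z∉q (here z≡0̂))
              (λ z≡1̂ → z∉q (subst (_∈ points i q) (sym z≡1̂) (points-last i q))))
          where
          ridge⊆p′ : ridge p z ⊆ inner p′
          ridge⊆p′ y∈ =
            let y∈inner , y≢z = ∈-ridge⁻ p z y∈
                y∈p , y≢0̂ , y≢1̂ = ∈-inner⁻ p y∈inner
            in ∈-inner⁺ p′ (kept y∈p y≢z) y≢0̂ y≢1̂

        _≺_ : Rel (List (V × ℤ)) 0ℓ
        F ≺ F′ = ∃[ p ] ∃[ q ] (F ≡ inner p × F′ ≡ inner q × points i p <ˡ points i q)

        -- The walks hidden in `F ≺ F′` can be exchanged for `p` and `q`, because the interior of a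
        -- walk determines its points and the order depends on these alone.
        ≺⇒<ˡ : ∀ {F F′} p q → F ⊆ inner p → inner q ⊆ F′ → F ≺ F′ → points i p <ˡ points i q
        ≺⇒<ˡ p q F⊆p q⊆F′ (p′ , q′ , refl , refl , p′<q′) =
          subst₂ _<ˡ_ (inner⊆⇒points≡ p′ p F⊆p) (sym (inner⊆⇒points≡ q q′ q⊆F′)) p′<q′

        module _ {Cs : List (List (V × ℤ))} (lex : IsLexOrdering _<ⱽ_ 0̂ 1̂ Cs) where
          open IsLexOrdering lex

          facets : List (List (V × ℤ))
          facets = map (removeEnds 0̂ 1̂) Cs

          chains-points : All (λ C → Σ[ p ∈ Walk (suc n) u v ] C ≡ points i p) Cs
          chains-points = All.zipWith (λ (max , asc) → maximal⇒points max asc) (maximal , ascending)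

          facets-inner : All (λ F → ∃[ p ] F ≡ inner p) facets
          facets-inner = All.map⁺ (All.map (λ (p , eq) → p , cong (removeEnds 0̂ 1̂) eq) chains-points)

          facets-sorted : AllPairs _≺_ facets
          facets-sorted = AllPairs.map⁺ (AllPairs-mapWith sorted chains-points increasing)
            where
            sorted : ∀ {C D} → Σ[ p ∈ Walk (suc n) u v ] C ≡ points i p →
                     Σ[ q ∈ Walk (suc n) u v ] D ≡ points i q →
                     C <ˡ D → removeEnds 0̂ 1̂ C ≺ removeEnds 0̂ 1̂ D
            sorted (p , refl) (q , refl) p<q = p , q , refl , refl , p<q

          -- `complete` gives a chain of `Cs` with the same elements; as that chain also lists the
          -- points of a walk, the two agree as lists.
          facets-complete : ∀ p → Any (inner p ≡_) facets
          facets-complete p =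
            let C , C∈Cs , p∼C = find (complete {points i p} (points-maximal p))
            in Any.map⁺ (lose C∈Cs (same (All.lookup chains-points C∈Cs) p∼C))
            where
            same : ∀ {C} → Σ[ q ∈ Walk (suc n) u v ] C ≡ points i q →
                   points i p ∼[ set ] C → inner p ≡ removeEnds 0̂ 1̂ C
            same (q , refl) p∼q =
              cong (removeEnds 0̂ 1̂) (points-injective p q (∼set⇒⊆ {ys = points i q} p∼q))

          isFacetOrdering : IsFacetOrdering Δ[ 0̂ , 1̂ ] facets
          isFacetOrdering = record
            { facets   = All.map (λ { (p , refl) → inner-facet p }) facets-inner
            ; complete = λ facet → let p , F⊆p , p⊆F = facet⇒inner facet in
                Any.map (λ p≡F {_} → ⊆∧⊇⇒∼set (⊆-reflexive p≡F ∘ F⊆p) (p⊆F ∘ ⊆-reflexive (sym p≡F)))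
                  (facets-complete p)
            -- If two facets at different positions had the same elements, `points i p` would
            -- precede itself.
            ; distinct = AllPairs.map
                (λ { F≺F′@(p , q , refl , refl , p<q) p∼q →
                       <ˡ-irrefl (points i p) (≺⇒<ˡ p p id (∼set⇒⊆ {xs = inner p} p∼q) F≺F′) })
                facets-sorted
            }

          facet-inner : ∀ j → ∃[ p ] lookup facets j ≡ inner p
          facet-inner j = All.lookup facets-inner (∈-lookup j)

          -- Every walk has its facet somewhere in the list. Position `j` is excluded by
          -- irreflexivity, and any later position by asymmetry.
          earlier-facet : ∀ {p q} j → lookup facets j ≡ inner q → points i p <ˡ points i q →
                          ∃[ h ] (h Fin.< j × lookup facets h ≡ inner p)
          earlier-facet {p} {q} j j≡q p<q = h , h<j (Fin.<-cmp h j) , h≡p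
            where
            h : Fin (length facets)
            h = Any.index (facets-complete p)
            h≡p : lookup facets h ≡ inner p
            h≡p = sym (Any.lookup-index (facets-complete p))
            h<j : Tri (h Fin.< j) (h ≡ j) (j Fin.< h) → h Fin.< j
            h<j (tri< h<j _ _) = h<j
            h<j (tri≈ _ h≡j _) = contradiction p<q (subst (λ C → ¬ (points i p <ˡ C))
              (inner⊆⇒points≡ p q (⊆-reflexive (trans (sym h≡p) (trans (cong (lookup facets) h≡j) j≡q))))
              (<ˡ-irrefl (points i p)))
            h<j (tri> _ _ j<h) = contradiction
              (≺⇒<ˡ q p (⊆-reflexive j≡q) (⊆-reflexive (sym h≡p)) (AllPairs-lookup facets-sorted j<h))
              (<ˡ-asym (points i p) (points i q) p<q)

          RidgeAbove : Fin (length facets) → List (V × ℤ) → Set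
          RidgeAbove j σ = ∃[ τ ] (EarlierFaces facets j τ × σ ⊆ τ × suc (length τ) ≡ n)

          -- The earlier facet `h` around `σ` is traded for the facet `h′` of the lowered walk,
          -- again earlier than `j`. The shared ridge of `p` and `p′` contains `inner p` ∩
          -- `inner q`, hence `σ`.
          earlierFace⊆ridge : ∀ j {σ} → EarlierFaces facets j σ → RidgeAbove j σ
          earlierFace⊆ridge j {σ} (_ , σ⊆j , h , h<j , σ⊆h) =
            let p , j≡p = facet-inner j
                q , h≡q = facet-inner h
                p′ , low = lowered p q j≡p h≡q
                h′ , h′<j , h′≡p′ = earlier-facet {p′} {p} j j≡p (Lowered⇒<ˡ i low)
            in ridgeAbove p p′ q h′ j≡p h≡q h′<j h′≡p′ (Lowered⇒ridge low)
            where
            lowered : ∀ p q → lookup facets j ≡ inner p → lookup facets h ≡ inner q →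
                      ∃[ p′ ] Lowered p p′ q
            lowered p q j≡p h≡q = <ˡ⇒Lowered i p q
              (≺⇒<ˡ q p (⊆-reflexive h≡q) (⊆-reflexive (sym j≡p)) (AllPairs-lookup facets-sorted h<j))

            ridgeAbove : ∀ p p′ q h′ → lookup facets j ≡ inner p → lookup facets h ≡ inner q →
                         h′ Fin.< j → lookup facets h′ ≡ inner p′ → SharedRidge p p′ q →
                         RidgeAbove j σ
            ridgeAbove p p′ q h′ j≡p h≡q h′<j h′≡p′ (τ , !τ , τ⊆p , τ⊆p′ , p∩q⊆τ , ∣τ∣) =
              τ ,
              ( !τ
              , (λ y∈ → ⊆-reflexive (sym j≡p) (τ⊆p y∈))
              , h′ , h′<j
              , (λ y∈ → ⊆-reflexive (sym h′≡p′) (τ⊆p′ y∈)) ) ,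
              (λ y∈ → p∩q⊆τ (⊆-reflexive j≡p (σ⊆j y∈)) (⊆-reflexive h≡q (σ⊆h y∈))) ,
              ∣τ∣

          earlier-isPure : ∀ j → 0 ℕ.< Fin.toℕ j → IsPure (EarlierFaces facets j) (+ n ℤ.- 1ℤ ℤ.- 1ℤ)
          earlier-isPure j 0<j = covered⇒isPure
            (record
              { faces-unique = proj₁
              ; down-closed  = λ (_ , σ⊆j , h , h<j , σ⊆h) !τ τ⊆σ →
                  !τ , σ⊆j ∘ τ⊆σ , h , h<j , σ⊆h ∘ τ⊆σ
              })
            ([] , ∅-earlier)
            (λ earlier → ridge-dim (earlierFace⊆ridge j earlier))
            where
            predecessor : ∀ {m} (j : Fin m) → 0 ℕ.< Fin.toℕ j → Σ[ h ∈ Fin m ] h Fin.< j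
            predecessor (suc j) _ = zero , s≤s z≤n

            -- Since `j` is not the first position, the empty set is an earlier face; the ridge
            -- around it attains the dimension.
            ∅-earlier : EarlierFaces facets j []
            ∅-earlier = let h , h<j = predecessor j 0<j in [] , (λ ()) , h , h<j , λ ()

            ridge-dim : ∀ {σ} → RidgeAbove j σ →
                        ∃[ τ ] (EarlierFaces facets j τ × σ ⊆ τ × dim τ ≡ + n ℤ.- 1ℤ ℤ.- 1ℤ)
            ridge-dim (τ , earlier , σ⊆τ , ∣τ∣) =
              -- Here `+ suc (length τ) ℤ.- 1ℤ` computes to `+ length τ`, so the size equation
              -- yields the dimension.
              τ , earlier , σ⊆τ , cong (λ l → + l ℤ.- 1ℤ ℤ.- 1ℤ) ∣τ∣

          isShelling : IsShelling Δ[ 0̂ , 1̂ ] facets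
          isShelling = record
            { dimension       = + n ℤ.- 1ℤ
            ; isPure          = Δ-isPure
            ; isFacetOrdering = isFacetOrdering
            ; earlier-pure    = earlier-isPure
            }

      -- With the length `k` free, matching on the level equation puts the interval into the form
      -- used in `Between`. Length zero would force `i` and `j` to coincide.
      lexOrdering-isShelling :
        ∀ {i j} → i ℤ.< j → i ℤ.+ + k ≡ j → Walk k u v →
        (∃[ Cs ] IsLexOrdering _<ⱽ_ (u , i) (v , j) Cs) ×
        (∀ Cs → IsLexOrdering _<ⱽ_ (u , i) (v , j) Cs →
          IsShelling Δ[ (u , i) , (v , j) ] (map (removeEnds (u , i) (v , j)) Cs))
      lexOrdering-isShelling {i = i} i<j refl [] =
        contradiction i<j (ℤ.<-irrefl (sym (ℤ.+-identityʳ i)))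
      lexOrdering-isShelling {i = i} _ refl p@(_ ∷ _) =
        (_ , lexOrdering i p) , λ _ → isShelling i p

theorem6p2 :
    (G : Digraph) →
    let open Digraph G
        open LevelPoset G
    in
    (_<ⱽ_ : Rel V 0ℓ) → IsVertexShellingOrder _<ⱽ_ →
    (u v : V) (i j : ℤ) → (u , i) < (v , j) →
    (∃[ Cs ] IsLexOrdering _<ⱽ_ (u , i) (v , j) Cs) ×
    (∀ Cs → IsLexOrdering _<ⱽ_ (u , i) (v , j) Cs →
      IsShelling Δ[ (u , i) , (v , j) ] (map (removeEnds (u , i) (v , j)) Cs))
theorem6p2 G _<ⱽ_ shelling u v i j (i<j , p) =
  lexOrdering-isShelling G _<ⱽ_ shelling i<j (i+∣j-i∣≡j i<j) p
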